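{- Let $\mathcal{H}$ be a set of graphs such that no graph in $\mathcal{H}$ contains a dominating vertex and no graph in $\mathcal{H}$ contains a pair of non-adjacent vertices that are complete to the remainder of the graph. Then the class of $\mathcal{H}$-free atoms has bounded clique-width if and only if the class of $\mathcal{H}$-free graphs has bounded clique-width.
   Context: Graphs are finite, simple and undirected. A graph is $\mathcal{H}$-free if it contains no graph of $\mathcal{H}$ as an induced subgraph. A vertex $u$ of $G$ is dominating if it is adjacent to every vertex of $V(G)\setminus\{u\}$. A pair of (distinct) non-adjacent vertices $u,v$ is complete to the remainder of the graph if both $u$ and $v$ are adjacent to every vertex of $V(G)\setminus\{u,v\}$. A clique $K\subseteq V(G)$ (possibly empty) is a clique cut-set of $G$ if $G\setminus K$ is disconnected; an atom is a graph with no clique cut-set (so atoms are connected). The clique-width $\mathrm{cw}(G)$ is the minimum number of labels needed to construct $G$ using four operations: create a new graph consisting of a single vertex with label $i$; take the disjoint union of two labelled graphs; add an edge between every vertex with label $i$ and every vertex with label $j$ ($i\ne j$); relabel every vertex with label $i$ to have label $j$. A class of graphs has bounded clique-width if there is a constant $c$ with $\mathrm{cw}(G)\le c$ for every $G$ in the class; otherwise its clique-width is unbounded. -}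

module Defs where

open import Data.Bool.Base using (if_then_else_)
open import Data.Empty using (⊥)
open import Data.Fin.Base using (Fin)
open import Data.Fin.Properties using (_≟_)
open import Data.Fin.Subset using (Subset; ∁) renaming (_∈_ to _∈ₛ_)
open import Data.Nat.Base using (ℕ; _≤_)
open import Data.Product.Base using (Σ; ∃; _×_)
open import Data.Sum.Base using (_⊎_; inj₁; inj₂)
open import Data.Unit.Base using (⊤)
open import Function.Bundles using (_⇔_; _↔_; _↣_; module Inverse; module Injection)
open import Level using (Level; 0ℓ; _⊔_) renaming (suc to lsuc)
open import Relation.Binary.Construct.Closure.ReflexiveTransitive using (Star)
open import Relation.Binary.Core using (Rel)
open import Relation.Binary.Definitions using (Decidable; Irreflexive; Symmetric)
open import Relation.Binary.PropositionalEquality.Core using (_≡_; _≢_)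
open import Relation.Nullary using (¬_; does)
open import Relation.Unary using (Pred; _∈_)

private
  variable
    ℓ : Level
    k : ℕ

record Graph : Set₁ where
  field
    order  : ℕ
    _~_    : Rel (Fin order) 0ℓ
    _~?_   : Decidable _~_
    sym    : Symmetric _~_
    irrefl : Irreflexive _≡_ _~_

  Vertex : Set
  Vertex = Fin order

  IsDominating : Vertex → Set
  IsDominating u = ∀ v → v ≢ u → u ~ v

  IsNonAdjacentCompletePair : Vertex → Vertex → Set
  IsNonAdjacentCompletePair u v =
    u ≢ v × ¬ (u ~ v) × (∀ w → w ≢ u → w ≢ v → u ~ w × v ~ w)

  IsClique : Subset order → Set
  IsClique K = ∀ {u v} → u ∈ₛ K → v ∈ₛ K → u ≢ v → u ~ v

  -- Adjacency in the subgraph induced by S.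
  Induced : Subset order → Rel Vertex 0ℓ
  Induced S u v = u ∈ₛ S × v ∈ₛ S × u ~ v

  -- Connectedness of the subgraph induced by S.  The null graph counts as
  -- connected, so the vertex set of a complete graph is not a cut-set.
  IsConnectedOn : Subset order → Set
  IsConnectedOn S = ∀ {u v} → u ∈ₛ S → v ∈ₛ S → Star (Induced S) u v

  IsCliqueCutset : Subset order → Set
  IsCliqueCutset K = IsClique K × ¬ IsConnectedOn (∁ K)

  IsAtom : Set
  IsAtom = ¬ ∃ IsCliqueCutset

open Graph public using
  (IsDominating; IsNonAdjacentCompletePair; IsClique; IsCliqueCutset; IsAtom)

-- H ⊑ G : H is isomorphic to an induced subgraph of G.
_⊑_ : Graph → Graph → Set
H ⊑ G = Σ (H.Vertex ↣ G.Vertex) λ f →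
  ∀ u v → (u H.~ v) ⇔ (Injection.to f u G.~ Injection.to f v)
  where
  module H = Graph H
  module G = Graph G

Free : Pred Graph ℓ → Pred Graph (lsuc 0ℓ ⊔ ℓ)
Free 𝓗 G = ∀ H → H ∈ 𝓗 → ¬ (H ⊑ G)

-- The four clique-width operations with labels drawn from Fin k.
data Expr (k : ℕ) : Set where
  vertex  : Fin k → Expr k
  _⊕_     : Expr k → Expr k → Expr k
  join    : (i j : Fin k) → i ≢ j → Expr k → Expr k
  relabel : (i j : Fin k) → Expr k → Expr k

-- The labelled graph an expression builds: vertices, labels and adjacency.
⟦_⟧ : Expr k → Set
⟦ vertex _ ⟧      = ⊤
⟦ e ⊕ f ⟧         = ⟦ e ⟧ ⊎ ⟦ f ⟧
⟦ join _ _ _ e ⟧  = ⟦ e ⟧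
⟦ relabel _ _ e ⟧ = ⟦ e ⟧

label : (e : Expr k) → ⟦ e ⟧ → Fin k
label (vertex i)      _        = i
label (e ⊕ f)         (inj₁ u) = label e u
label (e ⊕ f)         (inj₂ v) = label f v
label (join _ _ _ e)  u        = label e u
label (relabel i j e) u        = if does (label e u ≟ i) then j else label e u

Adj : (e : Expr k) → Rel ⟦ e ⟧ 0ℓ
Adj (vertex _)      _        _        = ⊥
Adj (e ⊕ f)         (inj₁ u) (inj₁ v) = Adj e u v
Adj (e ⊕ f)         (inj₁ _) (inj₂ _) = ⊥
Adj (e ⊕ f)         (inj₂ _) (inj₁ _) = ⊥
Adj (e ⊕ f)         (inj₂ u) (inj₂ v) = Adj f u v
Adj (join i j _ e)  u        v        =
  Adj e u v ⊎ (label e u ≡ i × label e v ≡ j) ⊎ (label e u ≡ j × label e v ≡ i)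
Adj (relabel _ _ e) u        v        = Adj e u v

_Builds_ : Expr k → Graph → Set
e Builds G = Σ (G.Vertex ↔ ⟦ e ⟧) λ φ →
  ∀ u v → (u G.~ v) ⇔ Adj e (Inverse.to φ u) (Inverse.to φ v)
  where module G = Graph G

Constructible : Graph → ℕ → Set
Constructible G k = Σ (Expr k) (_Builds G)

IsCliqueWidth : Graph → ℕ → Set
IsCliqueWidth G k = Constructible G k × (∀ j → Constructible G j → k ≤ j)

-- The minimum is a functional relation rather than a function: computing it
-- needs a search over expressions.  It is defined for every graph except the
-- null graph, which no expression builds and which therefore has no
-- clique-width to bound.
BoundedCliqueWidth : Pred Graph ℓ → Set (lsuc 0ℓ ⊔ ℓ)
BoundedCliqueWidth 𝓒 = ∃ λ c → ∀ G → G ∈ 𝓒 → ∀ k → IsCliqueWidth G k → k ≤ c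

{-# OPTIONS --safe #-}
-- If G is complete then it is itself an atom.  Otherwise consider the suspension
-- G′ of G, obtained by adding two non-adjacent vertices (poles) complete to G.
-- A clique K cannot contain G, nor both poles; so a vertex of G survives in
-- G′ ∖ K together with a pole adjacent to it, and G′ is an atom.  An induced copy
-- of H ∈ 𝓗 in G′ using a pole would have a dominating vertex or a non-adjacent
-- pair complete to the rest, so G′ is 𝓗-free.  Finally cw(G) ≤ cw(G′) because G
-- is an induced subgraph of G′.
module Submission where

open import Data.Empty using (⊥; ⊥-elim)
open import Data.Fin.Base using (Fin; zero; suc)
open import Data.Fin.Properties using (_≟_; any?; 1↔⊤; +↔⊎; suc-injective)
open import Data.Fin.Subset using (Subset; ∁) renaming (_∈_ to _∈ₛ_)
open import Data.Fin.Subset.Properties using (x∉p⇒x∈∁p; x∉∁p⇒x∈p; _∈?_)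
open import Data.List.Base using (List; []; _∷_; allFin; cartesianProduct)
open import Data.List.Membership.Propositional using (find; lose)
open import Data.List.Membership.Propositional.Properties using (∈-allFin; ∈-cartesianProduct⁺)
open import Data.List.Relation.Unary.Any using (Any; here; there)
open import Data.Nat.Base using (ℕ; zero; suc; _≤_; _<_)
open import Data.Nat.Induction using (<-rec)
open import Data.Nat.Properties using (≤-trans; ≮⇒≥; _≤?_)
open import Data.Product.Base using (∃; ∃₂; _×_; _,_; proj₁; proj₂)
open import Data.Product.Function.NonDependent.Propositional using (_×-⇔_)
open import Data.Sum.Base using (_⊎_; inj₁; inj₂) renaming (map to map⊎)
open import Data.Sum.Function.Propositional using (_⊎-↔_; _⊎-⇔_)
open import Data.Sum.Properties using (inj₁-injective; inj₂-injective)
open import Data.Unit.Base using (⊤; tt)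
open import Function.Base using (_∘_; id)
open import Function.Bundles using (_⇔_; _↔_; mk⇔; mk↣; mk↔ₛ′; module Equivalence; module Inverse; module Injection)
open import Function.Construct.Composition using (_↔-∘_)
open import Function.Construct.Identity using (⇔-id)
open import Level using (0ℓ)
open import Relation.Binary.Construct.Closure.ReflexiveTransitive using (Star; ε; _◅_; _◅◅_; reverse)
open import Relation.Binary.Core using (Rel)
open import Relation.Binary.PropositionalEquality using (_≡_; _≢_; refl; sym; trans; cong; subst₂)
open import Relation.Nullary using (¬_; Dec; yes; no; contradiction)
open import Relation.Nullary.Decidable using (decidable-stable; _×-dec_; ¬?)
open import Relation.Unary using (Pred; Decidable; Empty; _∈_; _∩_)
open import Defs

open Equivalence using (to; from)

private
  variable
    k m n : ℕ

-- `P` need not be decidable, so a least witness is obtained only up to double negation: if there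
-- were none, strong induction would refute `P` at every number.
¬¬-least : ∀ {p} (P : Pred ℕ p) → ∃ P → ¬ ¬ ∃ (λ m → P m × (∀ j → P j → m ≤ j))
¬¬-least P (k , Pk) none = <-rec (¬_ ∘ P) step k Pk
  where
  step : ∀ n → (∀ {m} → m < n → ¬ P m) → ¬ P n
  step n below Pn = none (n , Pn , λ j Pj → ≮⇒≥ λ j<n → below j<n Pj)

≡-⇔ : ∀ {A : Set} {x y : A} (z : A) → x ≡ y → (x ≡ z) ⇔ (y ≡ z)
≡-⇔ z x≡y = mk⇔ (trans (sym x≡y)) (trans x≡y)

-- Induced subgraphs

-- `expr` builds the subgraph induced by `P` from the same label set `Fin k`. Exact preservation of
-- labels is what carries the induction through `join` and `relabel`.
record Restriction (e : Expr k) (P : Pred ⟦ e ⟧ 0ℓ) : Set where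
  field
    expr      : Expr k
    embed     : ⟦ expr ⟧ → ⟦ e ⟧
    injective : ∀ {x y} → embed x ≡ embed y → x ≡ y
    label-≡   : ∀ x → label expr x ≡ label e (embed x)
    adj-⇔     : ∀ x y → Adj expr x y ⇔ Adj e (embed x) (embed y)
    sound     : ∀ x → P (embed x)
    complete  : ∀ {y} → P y → ∃ λ x → embed x ≡ y

-- Leaves outside `P` are deleted. No expression builds the null graph, so emptiness is a separate
-- outcome, and a union with one empty side collapses to the other side.
restrict : (e : Expr k) (P : Pred ⟦ e ⟧ 0ℓ) → Decidable P → Empty P ⊎ Restriction e P
restrict (vertex i) P P? with P? tt
... | no ¬p = inj₁ λ _ → ¬p
... | yes p = inj₂ record
  { expr      = vertex i
  ; embed     = id
  ; injective = id
  ; label-≡   = λ _ → refl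
  ; adj-⇔     = λ _ _ → ⇔-id _
  ; sound     = λ _ → p
  ; complete  = λ {y} _ → y , refl
  }
restrict (e ⊕ f) P P?
  with restrict e (P ∘ inj₁) (P? ∘ inj₁) | restrict f (P ∘ inj₂) (P? ∘ inj₂)
... | inj₁ ∅ₑ | inj₁ ∅f = inj₁ λ { (inj₁ x) → ∅ₑ x ; (inj₂ y) → ∅f y }
... | inj₂ r  | inj₁ ∅f = inj₂ record
  { expr      = expr
  ; embed     = inj₁ ∘ embed
  ; injective = injective ∘ inj₁-injective
  ; label-≡   = label-≡
  ; adj-⇔     = adj-⇔
  ; sound     = sound
  ; complete  = λ { {inj₁ _} p → let x , eq = complete p in x , cong inj₁ eq
                  ; {inj₂ y} p → ⊥-elim (∅f y p) }
  }
  where open Restriction r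
... | inj₁ ∅ₑ | inj₂ r = inj₂ record
  { expr      = expr
  ; embed     = inj₂ ∘ embed
  ; injective = injective ∘ inj₂-injective
  ; label-≡   = label-≡
  ; adj-⇔     = adj-⇔
  ; sound     = sound
  ; complete  = λ { {inj₁ x} p → ⊥-elim (∅ₑ x p)
                  ; {inj₂ _} p → let y , eq = complete p in y , cong inj₂ eq }
  }
  where open Restriction r
... | inj₂ r | inj₂ s = inj₂ record
  { expr      = r.expr ⊕ s.expr
  ; embed     = map⊎ r.embed s.embed
  ; injective = λ { {inj₁ _} {inj₁ _} eq → cong inj₁ (r.injective (inj₁-injective eq))
                  ; {inj₁ _} {inj₂ _} ()
                  ; {inj₂ _} {inj₁ _} ()
                  ; {inj₂ _} {inj₂ _} eq → cong inj₂ (s.injective (inj₂-injective eq)) }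
  ; label-≡   = λ { (inj₁ x) → r.label-≡ x ; (inj₂ y) → s.label-≡ y }
  ; adj-⇔     = λ { (inj₁ x) (inj₁ y) → r.adj-⇔ x y
                  ; (inj₁ _) (inj₂ _) → ⇔-id ⊥
                  ; (inj₂ _) (inj₁ _) → ⇔-id ⊥
                  ; (inj₂ x) (inj₂ y) → s.adj-⇔ x y }
  ; sound     = λ { (inj₁ x) → r.sound x ; (inj₂ y) → s.sound y }
  ; complete  = λ { {inj₁ _} p → let x , eq = r.complete p in inj₁ x , cong inj₁ eq
                  ; {inj₂ _} p → let y , eq = s.complete p in inj₂ y , cong inj₂ eq }
  }
  where
  module r = Restriction r
  module s = Restriction s
restrict (join i j i≢j e) P P? with restrict e P P?
... | inj₁ ∅ = inj₁ ∅
... | inj₂ r = inj₂ record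
  { expr      = join i j i≢j expr
  ; embed     = embed
  ; injective = injective
  ; label-≡   = label-≡
  ; adj-⇔     = λ x y → adj-⇔ x y
      ⊎-⇔ ((≡-⇔ i (label-≡ x) ×-⇔ ≡-⇔ j (label-≡ y))
      ⊎-⇔ (≡-⇔ j (label-≡ x) ×-⇔ ≡-⇔ i (label-≡ y)))
  ; sound     = sound
  ; complete  = complete
  }
  where open Restriction r
restrict (relabel i j e) P P? with restrict e P P?
... | inj₁ ∅ = inj₁ ∅
... | inj₂ r = inj₂ record
  { expr      = relabel i j expr
  ; embed     = embed
  ; injective = injective
  ; label-≡   = relabelled
  ; adj-⇔     = adj-⇔
  ; sound     = sound
  ; complete  = complete
  }
  where
  open Restriction r
  relabelled : ∀ x → label (relabel i j expr) x ≡ label (relabel i j e) (embed x)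
  relabelled x rewrite label-≡ x = refl

-- The expression for `G′` is restricted to the image of `G`. The vertex `v₀` rules out an empty
-- image, for which there is no expression.
⊑-constructible : ∀ {G G′} → Graph.Vertex G → G ⊑ G′ → Constructible G′ k → Constructible G k
⊑-constructible {k} {G} {G′} v₀ (f , f-adj) (e , φ , φ-adj)
  -- The image is described through `Inverse.from φ`, that is in `Fin`, where equality is decidable.
  with restrict e (λ x → ∃ λ v → Injection.to f v ≡ Inverse.from φ x)
                  (λ x → any? λ v → Injection.to f v ≟ Inverse.from φ x)
... | inj₁ ∅ = ⊥-elim (∅ (Inverse.to φ (Injection.to f v₀)) (v₀ , sym (Inverse.strictlyInverseʳ φ _)))
... | inj₂ r = expr , mk↔ₛ′ pull back pull-back back-pull , adj
  where
  open Restriction r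
  module f = Injection f
  module φ = Inverse φ

  preimage : ∀ v → ∃ λ x → embed x ≡ φ.to (f.to v)
  preimage v = complete (v , sym (φ.strictlyInverseʳ _))

  pull : Graph.Vertex G → ⟦ expr ⟧
  pull v = proj₁ (preimage v)

  back : ⟦ expr ⟧ → Graph.Vertex G
  back x = proj₁ (sound x)

  pull-back : ∀ x → pull (back x) ≡ x
  pull-back x = injective (trans (proj₂ (preimage (back x)))
    (trans (cong φ.to (proj₂ (sound x))) (φ.strictlyInverseˡ _)))

  back-pull : ∀ v → back (pull v) ≡ v
  back-pull v = f.injective (trans (proj₂ (sound (pull v)))
    (trans (cong φ.from (proj₂ (preimage v))) (φ.strictlyInverseʳ _)))

  adj : ∀ u v → Graph._~_ G u v ⇔ Adj expr (pull u) (pull v)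
  adj u v = mk⇔
    (λ u~v → from (adj-⇔ _ _) (subst₂ (Adj e) (sym (proj₂ (preimage u))) (sym (proj₂ (preimage v)))
                (to (φ-adj _ _) (to (f-adj u v) u~v))))
    (λ a → from (f-adj u v) (from (φ-adj _ _)
                (subst₂ (Adj e) (proj₂ (preimage u)) (proj₂ (preimage v)) (to (adj-⇔ _ _) a))))

-- Existence of the clique-width

-- A bare relation on `Fin m` with prescribed labels, rather than a `Graph`, so that edges can be
-- added one at a time while the labels stay fixed.
record Coloured (c : Fin m → Fin k) (R : Rel (Fin m) 0ℓ) : Set where
  field
    expr     : Expr k
    vertices : Fin m ↔ ⟦ expr ⟧
    label-≡  : ∀ v → label expr (Inverse.to vertices v) ≡ c v
    adj-⇔    : ∀ u v → R u v ⇔ Adj expr (Inverse.to vertices u) (Inverse.to vertices v)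

edgeless : (c : Fin (suc m) → Fin k) → Coloured c (λ _ _ → ⊥)
edgeless {zero} c = record
  { expr     = vertex (c zero)
  ; vertices = 1↔⊤
  ; label-≡  = λ { zero → refl }
  ; adj-⇔    = λ _ _ → ⇔-id ⊥
  }
edgeless {suc m} c = record
  { expr     = vertex (c zero) ⊕ expr
  ; vertices = (1↔⊤ ⊎-↔ vertices) ↔-∘ +↔⊎ {1}
  ; label-≡  = λ { zero → refl ; (suc v) → label-≡ v }
  ; adj-⇔    = λ { zero    zero    → ⇔-id ⊥
                 ; zero    (suc _) → ⇔-id ⊥
                 ; (suc _) zero    → ⇔-id ⊥
                 ; (suc u) (suc v) → adj-⇔ u v }
  }
  where open Coloured (edgeless (c ∘ suc))

Joined : (i j u v : Fin n) → Set
Joined i j u v = (u ≡ i × v ≡ j) ⊎ (u ≡ j × v ≡ i)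

module _ (G : Graph) where
  open Graph G

  Listed : List (Vertex × Vertex) → Rel Vertex 0ℓ
  Listed L u v = Any (λ (i , j) → i ~ j × Joined i j u v) L

  -- Under the colouring `id` every vertex has a label of its own, so joining labels `i` and `j`
  -- adds the single edge between these two vertices.
  withEdges : Coloured {order} id (λ _ _ → ⊥) → ∀ L → Coloured id (Listed L)
  withEdges r []            = record
    { Coloured r ; adj-⇔ = λ u v → mk⇔ (λ ()) (⊥-elim ∘ from (Coloured.adj-⇔ r u v)) }
  withEdges r ((i , j) ∷ L) with i ~? j
  ... | no i≁j = record
    { Coloured (withEdges r L)
    ; adj-⇔ = λ u v → mk⇔
        (λ { (here (i~j , _)) → contradiction i~j i≁j ; (there a) → to (adj-⇔ u v) a })
        (there ∘ from (adj-⇔ u v))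
    }
    where open Coloured (withEdges r L)
  ... | yes i~j = record
    { expr     = join i j (λ i≡j → irrefl i≡j i~j) expr
    ; vertices = vertices
    ; label-≡  = label-≡
    ; adj-⇔    = λ u v → mk⇔
        (λ { (here (_ , a)) → inj₂ (from (labels u v) a)
           ; (there a)      → inj₁ (to (adj-⇔ u v) a) })
        (λ { (inj₁ a) → there (from (adj-⇔ u v) a)
           ; (inj₂ a) → here (i~j , to (labels u v) a) })
    }
    where
    open Coloured (withEdges r L)
    labels : ∀ u v → Joined i j (label expr (Inverse.to vertices u)) (label expr (Inverse.to vertices v))
                     ⇔ Joined i j u v
    labels u v = (≡-⇔ i (label-≡ u) ×-⇔ ≡-⇔ j (label-≡ v))
             ⊎-⇔ (≡-⇔ j (label-≡ u) ×-⇔ ≡-⇔ i (label-≡ v))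

  allPairs : List (Vertex × Vertex)
  allPairs = cartesianProduct (allFin order) (allFin order)

  listed-all : ∀ u v → (u ~ v) ⇔ Listed allPairs u v
  listed-all u v = mk⇔
    (λ u~v → lose (∈-cartesianProduct⁺ (∈-allFin u) (∈-allFin v)) (u~v , inj₁ (refl , refl)))
    (λ a → edge (proj₂ (proj₂ (find a))))
    where
    edge : ∀ {i j} → i ~ j × Joined i j u v → u ~ v
    edge (i~j , inj₁ (refl , refl)) = i~j
    edge (i~j , inj₂ (refl , refl)) = Graph.sym G i~j

  -- The edgeless expression is an argument because `edgeless` covers positive order only, which
  -- becomes visible once `constructible` matches on `order`.
  edgeless-constructible : Coloured {order} id (λ _ _ → ⊥) → Constructible G order
  edgeless-constructible r = expr , vertices , λ u v →
    mk⇔ (to (adj-⇔ u v) ∘ to (listed-all u v)) (from (listed-all u v) ∘ from (adj-⇔ u v))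
    where open Coloured (withEdges r allPairs)

constructible : (G : Graph) → Graph.Vertex G → Constructible G (Graph.order G)
constructible G@record { order = suc _ } _ = edgeless-constructible G (edgeless id)

¬¬-cliqueWidth : (G : Graph) → Graph.Vertex G → ¬ ¬ ∃ (IsCliqueWidth G)
¬¬-cliqueWidth G v = ¬¬-least (Constructible G) (Graph.order G , constructible G v)

-- Monotonicity of clique-width under induced subgraphs

someVertex : (e : Expr k) → ⟦ e ⟧
someVertex (vertex _)      = tt
someVertex (e ⊕ _)         = inj₁ (someVertex e)
someVertex (join _ _ _ e)  = someVertex e
someVertex (relabel _ _ e) = someVertex e

constructible⇒vertex : ∀ {G} → Constructible G k → Graph.Vertex G
constructible⇒vertex (e , φ , _) = Inverse.from φ (someVertex e)

-- An expression for `G′` with `n` labels restricts to one for `G` with `n` labels, and `m` is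
-- minimal for `G`. That `G` has a vertex follows from its being built by an expression.
cliqueWidth-mono : ∀ {G G′} → G ⊑ G′ → IsCliqueWidth G m → IsCliqueWidth G′ n → m ≤ n
cliqueWidth-mono {G = G} {G′} G⊑G′ (Gₘ , least) (G′ₙ , _) =
  least _ (⊑-constructible {G = G} {G′} (constructible⇒vertex {G = G} Gₘ) G⊑G′ G′ₙ)

-- Complete graphs and suspensions

IsComplete : Graph → Set
IsComplete G = ∀ u v → u ≢ v → u ~ v
  where open Graph G

complete⇒atom : ∀ G → IsComplete G → IsAtom G
complete⇒atom G complete (K , _ , disconnected) = disconnected connected
  where
  connected : Graph.IsConnectedOn G (∁ K)
  connected {u} {v} u∉K v∉K with u ≟ v
  ... | yes refl = ε
  ... | no u≢v   = (u∉K , v∉K , complete u v u≢v) ◅ ε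

complete⊎missingEdge : ∀ G → IsComplete G ⊎ (∃₂ λ u v → u ≢ v × ¬ Graph._~_ G u v)
complete⊎missingEdge G with any? (λ u → any? λ v → ¬? (u ≟ v) ×-dec ¬? (Graph._~?_ G u v))
... | yes missing = inj₂ missing
... | no ∄missing = inj₁ λ u v u≢v →
  decidable-stable (Graph._~?_ G u v) λ u≁v → ∄missing (u , v , u≢v , u≁v)

pattern north = zero
pattern south = suc zero
pattern old v = suc (suc v)

module _ (G : Graph) where
  open Graph G using (order; _~_; _~?_; irrefl)

  SuspAdj : Rel (Fin (suc (suc order))) 0ℓ
  SuspAdj north   north   = ⊥
  SuspAdj north   south   = ⊥
  SuspAdj north   (old _) = ⊤
  SuspAdj south   north   = ⊥
  SuspAdj south   south   = ⊥
  SuspAdj south   (old _) = ⊤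
  SuspAdj (old _) north   = ⊤
  SuspAdj (old _) south   = ⊤
  SuspAdj (old u) (old v) = u ~ v

  suspension : Graph
  suspension = record
    { order  = suc (suc order)
    ; _~_    = SuspAdj
    ; _~?_   = adj?
    ; sym    = λ {u} {v} → adj-sym u v
    ; irrefl = λ { {u} refl → adj-irrefl u }
    }
    where
    adj? : ∀ u v → Dec (SuspAdj u v)
    adj? north   north   = no id
    adj? north   south   = no id
    adj? north   (old _) = yes tt
    adj? south   north   = no id
    adj? south   south   = no id
    adj? south   (old _) = yes tt
    adj? (old _) north   = yes tt
    adj? (old _) south   = yes tt
    adj? (old u) (old v) = u ~? v

    adj-sym : ∀ u v → SuspAdj u v → SuspAdj v u
    adj-sym north   (old _) _ = tt
    adj-sym south   (old _) _ = tt
    adj-sym (old _) north   _ = tt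
    adj-sym (old _) south   _ = tt
    adj-sym (old _) (old _) a = Graph.sym G a

    adj-irrefl : ∀ u → ¬ SuspAdj u u
    adj-irrefl (old u) a = irrefl refl a

  ⊑-suspension : G ⊑ suspension
  ⊑-suspension = mk↣ (suc-injective ∘ suc-injective) , λ _ _ → ⇔-id _

  suspension-atom : ∀ {a b} → a ≢ b → ¬ (a ~ b) → IsAtom suspension
  suspension-atom {a} {b} a≢b a≁b (K , clique , disconnected) = disconnected connected
    where
    S : Subset (suc (suc order))
    S = ∁ K

    _⟶*_ : Rel (Fin (suc (suc order))) 0ℓ
    _⟶*_ = Star (Graph.Induced suspension S)

    -- The non-adjacent vertices `a` and `b` cannot both lie in the clique `K`.
    survivor : ∃ λ w → old w ∈ₛ S
    survivor with old a ∈? S | old b ∈? S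
    ... | yes a∈S | _       = a , a∈S
    ... | no _    | yes b∈S = b , b∈S
    ... | no a∉S  | no b∉S  = contradiction
      (clique (x∉∁p⇒x∈p a∉S) (x∉∁p⇒x∈p b∉S) (a≢b ∘ suc-injective ∘ suc-injective)) a≁b

    -- A pole outside `K` serves as centre: surviving vertices of `G` are adjacent to it, and the
    -- other pole, if it survives, reaches it through `survivor`.
    hub : ∃ λ h → ∀ {x} → x ∈ₛ S → x ⟶* h
    hub with north ∈? S
    ... | yes n∈S = north , λ
      { {north} _   → ε
      ; {south} s∈S → let w , w∈S = survivor in (s∈S , w∈S , tt) ◅ (w∈S , n∈S , tt) ◅ ε
      ; {old x} x∈S → (x∈S , n∈S , tt) ◅ ε }
    ... | no n∉S = south , λ
      { {north} n∈S → contradiction n∈S n∉S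
      ; {south} _   → ε
      ; {old x} x∈S → (x∈S , s∈S , tt) ◅ ε }
      where
      s∈S : south ∈ₛ S
      -- If both poles were in `K` they would be adjacent, but their adjacency computes to `⊥`.
      s∈S = x∉p⇒x∈∁p λ s∈K → clique (x∉∁p⇒x∈p n∉S) s∈K λ ()

    connected : Graph.IsConnectedOn suspension S
    connected u∈S v∈S = proj₂ hub u∈S ◅◅ reverse back (proj₂ hub v∈S)
      where
      back : ∀ {x y} → Graph.Induced suspension S x y → Graph.Induced suspension S y x
      back {x} {y} (x∈S , y∈S , a) = y∈S , x∈S , Graph.sym suspension {x} {y} a

  -- If the copy meets both poles, their preimages form an excluded pair; if it meets exactly one,
  -- the preimage dominates `H`; if it meets neither, the copy lies in `G`.
  ⊑-suspension⁻¹ : ∀ {H} → ¬ ∃ (IsDominating H) → ¬ ∃₂ (IsNonAdjacentCompletePair H) →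
                   H ⊑ suspension → H ⊑ G
  ⊑-suspension⁻¹ {H} noDominating noPair (f , f-adj) =
    cases (any? λ x → f.to x ≟ north) (any? λ x → f.to x ≟ south)
    where
    module f = Injection f
    module H = Graph H

    avoid : ∀ {x y p} → f.to x ≡ p → y ≢ x → f.to y ≢ p
    avoid fx≡p y≢x fy≡p = y≢x (f.injective (trans fy≡p (sym fx≡p)))

    unold : ∀ z → z ≢ north → z ≢ south → ∃ λ w → z ≡ old w
    unold north   ≢n _  = contradiction refl ≢n
    unold south   _  ≢s = contradiction refl ≢s
    unold (old w) _  _  = w , refl

    -- A vertex of `H` sent to neither pole lands in `G`, to which each pole is complete; `f`
    -- reflects this adjacency back to `H`.
    pole-adj : ∀ {x y p} → f.to x ≡ p → (∀ w → SuspAdj p (old w)) →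
               f.to y ≢ north → f.to y ≢ south → x H.~ y
    pole-adj {x} {y} fx≡p p~old ≢n ≢s =
      let w , fy≡w = unold (f.to y) ≢n ≢s
      in from (f-adj x y) (subst₂ SuspAdj (sym fx≡p) (sym fy≡w) (p~old w))

    cases : Dec (∃ λ x → f.to x ≡ north) → Dec (∃ λ x → f.to x ≡ south) → H ⊑ G
    cases (yes (x , fx≡n)) (yes (y , fy≡s)) = contradiction
      (x , y
         , (λ { refl → contradiction (trans (sym fx≡n) fy≡s) λ () })
         , (λ x~y → subst₂ SuspAdj fx≡n fy≡s (to (f-adj x y) x~y))
         -- The placeholder is the completeness of the pole to `G`, whose values have type `⊤` and
         -- are filled in by eta.
         , λ w w≢x w≢y → pole-adj fx≡n _ (avoid fx≡n w≢x) (avoid fy≡s w≢y)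
                       , pole-adj fy≡s _ (avoid fx≡n w≢x) (avoid fy≡s w≢y))
      noPair
    cases (yes (x , fx≡n)) (no ∄s) = contradiction
      (x , λ v v≢x → pole-adj fx≡n _ (avoid fx≡n v≢x) (∄s ∘ (v ,_))) noDominating
    cases (no ∄n) (yes (y , fy≡s)) = contradiction
      (y , λ v v≢y → pole-adj fy≡s _ (∄n ∘ (v ,_)) (avoid fy≡s v≢y)) noDominating
    cases (no ∄n) (no ∄s) =
        mk↣ {to = λ v → proj₁ (lower v)} (λ {u} {v} eq →
          f.injective (trans (proj₂ (lower u)) (trans (cong (λ (w : Fin order) → old w) eq) (sym (proj₂ (lower v))))))
      , λ u v → mk⇔
          (λ u~v → subst₂ SuspAdj (proj₂ (lower u)) (proj₂ (lower v)) (to (f-adj u v) u~v))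
          (λ a → from (f-adj u v) (subst₂ SuspAdj (sym (proj₂ (lower u))) (sym (proj₂ (lower v))) a))
      where
      lower : ∀ v → ∃ λ w → f.to v ≡ old w
      lower v = unold (f.to v) (∄n ∘ (v ,_)) (∄s ∘ (v ,_))

-- Transfer of the bound between atoms and all graphs

lemma14 : ∀ {ℓ} (𝓗 : Pred Graph ℓ) →
    (∀ H → H ∈ 𝓗 → ¬ ∃ (IsDominating H)) →
    (∀ H → H ∈ 𝓗 → ¬ ∃₂ (IsNonAdjacentCompletePair H)) →
    BoundedCliqueWidth (Free 𝓗 ∩ IsAtom) ⇔ BoundedCliqueWidth (Free 𝓗)
lemma14 𝓗 noDominating noPair = mk⇔ (λ (c , bound) → c , extend c bound)
                                    -- In this direction the constant is kept, since the atoms form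
                                    -- a subclass.
                                    (λ (c , bound) → c , λ G (free , _) → bound G free)
  where
  -- The minimum defining the clique-width of the suspension exists only up to
  -- double negation, which suffices because m ≤ c is decidable.
  extend : ∀ c → (∀ G → G ∈ Free 𝓗 ∩ IsAtom → ∀ k → IsCliqueWidth G k → k ≤ c) →
           ∀ G → G ∈ Free 𝓗 → ∀ m → IsCliqueWidth G m → m ≤ c
  extend c bound G free m cwG with complete⊎missingEdge G
  ... | inj₁ complete = bound G (free , complete⇒atom G complete) m cwG
  ... | inj₂ (_ , _ , a≢b , a≁b) = decidable-stable (m ≤? c) λ m≰c →
    ¬¬-cliqueWidth (suspension G) north λ (n , cwG′) → m≰c
      (≤-trans (cliqueWidth-mono {G = G} {suspension G} (⊑-suspension G) cwG cwG′)
               (bound (suspension G) (suspensionFree , suspension-atom G a≢b a≁b) n cwG′))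
    where
    suspensionFree : suspension G ∈ Free 𝓗
    suspensionFree H H∈𝓗 H⊑G′ =
      free H H∈𝓗 (⊑-suspension⁻¹ G {H} (noDominating H H∈𝓗) (noPair H H∈𝓗) H⊑G′)
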